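{- Let $k$ be a positive integer and let $\mathcal{C}$ be any one of the following five classes of independence systems: $k$-matroid intersection systems, $k$-matchoids, $k$-circuit bounded systems, $k$-growth systems, $k$-extendible systems. If $\mathcal{F}=(S,\mathcal{I})$ belongs to $\mathcal{C}$, then so do all parallel extensions, restrictions and contractions of $\mathcal{F}$.
   Context: An independence system $(S,\mathcal{I})$ is a finite set $S$ with a nonempty downward-closed family $\mathcal{I}\subseteq2^S$ of independent sets. Circuits are the minimal non-independent sets; a loop is a circuit of size 1. A basis of $X\subseteq S$ is a maximal independent subset of $X$. Parallel extension of $\mathcal{F}$ along a non-loop element $s\in S$: ground set $S_{\circ s}=(S\setminus\{s\})\cup\{s_1,s_2\}$ with new elements $s_1,s_2$; for $X\subseteq S_{\circ s}$ let $\pi_s(X)=X$ if $X\cap\{s_1,s_2\}=\emptyset$ and $\pi_s(X)=(X\setminus\{s_1,s_2\})\cup\{s\}$ otherwise; the independent sets are the $X\subseteq S_{\circ s}$ with $|X\cap\{s_1,s_2\}|\le1$ and $\pi_s(X)\in\mathcal{I}$. Restriction to $Y\subseteq S$: $(Y,\{X\subseteq Y:X\in\mathcal{I}\})$. Contraction of $I\in\mathcal{I}$: $(S\setminus I,\{X\subseteq S\setminus I:X\cup I\in\mathcal{I}\})$. $k$-matroid intersection: $\mathcal{I}=\bigcap_{i=1}^k\mathcal{I}_i$ for some matroids $(S,\mathcal{I}_i)$, $i\in[k]$. $k$-matchoid: there are matroids $(S_i,\mathcal{I}_i)$, $i\in[N]$, with $S=\bigcup_iS_i$, each $e\in S$ in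 at most $k$ of the $S_i$, and $\mathcal{I}=\{F\subseteq S:F\cap S_i\in\mathcal{I}_i\ \forall i\}$. $k$-circuit bounded: for every $I\in\mathcal{I}$ and $e\in S\setminus I$, $I\cup\{e\}$ contains at most $k$ distinct circuits. $k$-growth: for all $X\subseteq S$ and $I\in\mathcal{I}$ there is a partition $(Q,Z)$ of $I\setminus X$ with $|Z|\le k|X\setminus I|$ such that $P\cup Q\in\mathcal{I}$ for every basis $P$ of $X$. $k$-extendible: for every $A\subseteq B\in\mathcal{I}$ and $e\in S\setminus B$ with $A\cup\{e\}\in\mathcal{I}$, there is $Z\subseteq B\setminus A$ with $|Z|\le k$ and $(B\cup\{e\})\setminus Z\in\mathcal{I}$. -}

module Defs where

open import Level using (_⊔_) renaming (suc to lsuc; zero to lzero)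
open import Data.Fin using (Fin; zero; suc)
open import Data.Fin.Subset
open import Data.Fin.Subset.Properties
open import Data.List using (length)
import Data.List as List
open import Data.List.Relation.Unary.All using (All)
open import Data.List.Relation.Unary.Unique.Propositional using (Unique)
open import Data.Nat using (ℕ; _+_; _*_; _≤_; _<_; z≤n; _≤?_)
open import Data.Nat.Properties using (≤-trans)
open import Data.Product using (Σ-syntax; ∃; ∃-syntax; _×_; _,_; proj₁; proj₂)
open import Data.Sum using (inj₁; inj₂)
open import Data.Vec using (_∷_; here; there; lookup; tabulate)
open import Function using (_∘_; _⇔_)
open import Relation.Binary.PropositionalEquality using (_≡_; sym; trans; cong; subst)
open import Relation.Nullary using (¬_)
open import Relation.Nullary.Decidable using (_×-dec_)
open import Relation.Unary using (Decidable)

private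
  variable
    n : ℕ

-- The finite ground set S is a subset of an ambient Fin n (ambient elements
-- outside S play no role), so that the ground set of a restriction or a
-- contraction is again a subset of the same ambient set.  Independence is
-- decidable, as for any family of subsets of a finite set classically.
record IndependenceSystem (n : ℕ) : Set₁ where
  field
    ground     : Subset n
    Ind        : Subset n → Set
    Ind?       : Decidable Ind
    ind⊆ground : ∀ {X} → Ind X → X ⊆ ground
    nonempty   : ∃ Ind
    closed     : ∀ {X Y} → Y ⊆ X → Ind X → Ind Y

open IndependenceSystem

∪-monoˡ : ∀ {X Y : Subset n} (Z : Subset n) → Y ⊆ X → Y ∪ Z ⊆ X ∪ Z
∪-monoˡ {X = X} {Y} Z Y⊆X x∈ with x∈p∪q⁻ Y Z x∈
... | inj₁ x∈Y = x∈p∪q⁺ (inj₁ (Y⊆X x∈Y))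
... | inj₂ x∈Z = x∈p∪q⁺ {p = X} (inj₂ x∈Z)

∩-monoˡ : ∀ {X Y : Subset n} (Z : Subset n) → Y ⊆ X → Y ∩ Z ⊆ X ∩ Z
∩-monoˡ {Y = Y} Z Y⊆X x∈ with x∈p∩q⁻ Y Z x∈
... | x∈Y , x∈Z = x∈p∩q⁺ (Y⊆X x∈Y , x∈Z)

empty-ind : (F : IndependenceSystem n) → Ind F ⊥
empty-ind F = closed F ⊥⊆ (proj₂ (nonempty F))

restrict : IndependenceSystem n → Subset n → IndependenceSystem n
restrict F Y = record
  { ground     = Y
  ; Ind        = λ X → X ⊆ Y × Ind F X
  ; Ind?       = λ X → X ⊆? Y ×-dec Ind? F X
  ; ind⊆ground = proj₁
  ; nonempty   = ⊥ , ⊥⊆ , empty-ind F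
  ; closed     = λ W⊆X (X⊆Y , indX) → X⊆Y ∘ W⊆X , closed F W⊆X indX
  }

contract : (F : IndependenceSystem n) (I : Subset n) → Ind F I → IndependenceSystem n
contract F I indI = record
  { ground     = ground F ─ I
  ; Ind        = λ X → X ⊆ ground F ─ I × Ind F (X ∪ I)
  ; Ind?       = λ X → X ⊆? (ground F ─ I) ×-dec Ind? F (X ∪ I)
  ; ind⊆ground = proj₁
  ; nonempty   = ⊥ , ⊥⊆ , subst (Ind F) (sym (∪-identityˡ I)) indI
  ; closed     = λ W⊆X (X⊆ , indX) → X⊆ ∘ W⊆X , closed F (∪-monoˡ I W⊆X) indX
  }

-- The parallel extension lives in the ambient set Fin (2 + n): the new elements
-- s₁ and s₂ are 0 and 1, and an old element e is renamed to suc (suc e).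
s₁ s₂ : Fin (2 + n)
s₁ = zero
s₂ = suc zero

⁅s₁,s₂⁆ : Subset (2 + n)
⁅s₁,s₂⁆ = ⁅ s₁ ⁆ ∪ ⁅ s₂ ⁆

π : Fin n → Subset (2 + n) → Subset n
π s (outside ∷ outside ∷ X) = X
π s (inside  ∷ outside ∷ X) = X ∪ ⁅ s ⁆
π s (outside ∷ inside  ∷ X) = X ∪ ⁅ s ⁆
π s (inside  ∷ inside  ∷ X) = X ∪ ⁅ s ⁆

π-mono : ∀ (s : Fin n) (X Y : Subset (2 + n)) → Y ⊆ X → π s Y ⊆ π s X
π-mono s (outside ∷ outside ∷ X) (outside ∷ outside ∷ Y) h = drop-∷-⊆ (drop-∷-⊆ h)
π-mono s (inside  ∷ outside ∷ X) (outside ∷ outside ∷ Y) h = p⊆p∪q _ ∘ drop-∷-⊆ (drop-∷-⊆ h)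
π-mono s (outside ∷ inside  ∷ X) (outside ∷ outside ∷ Y) h = p⊆p∪q _ ∘ drop-∷-⊆ (drop-∷-⊆ h)
π-mono s (inside  ∷ inside  ∷ X) (outside ∷ outside ∷ Y) h = p⊆p∪q _ ∘ drop-∷-⊆ (drop-∷-⊆ h)
π-mono s (inside  ∷ outside ∷ X) (inside  ∷ outside ∷ Y) h = ∪-monoˡ ⁅ s ⁆ (drop-∷-⊆ (drop-∷-⊆ h))
π-mono s (inside  ∷ inside  ∷ X) (inside  ∷ outside ∷ Y) h = ∪-monoˡ ⁅ s ⁆ (drop-∷-⊆ (drop-∷-⊆ h))
π-mono s (outside ∷ inside  ∷ X) (outside ∷ inside  ∷ Y) h = ∪-monoˡ ⁅ s ⁆ (drop-∷-⊆ (drop-∷-⊆ h))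
π-mono s (inside  ∷ inside  ∷ X) (outside ∷ inside  ∷ Y) h = ∪-monoˡ ⁅ s ⁆ (drop-∷-⊆ (drop-∷-⊆ h))
π-mono s (inside  ∷ inside  ∷ X) (inside  ∷ inside  ∷ Y) h = ∪-monoˡ ⁅ s ⁆ (drop-∷-⊆ (drop-∷-⊆ h))
π-mono s (outside ∷ _       ∷ X) (inside  ∷ _       ∷ Y) h with () ← h here
π-mono s (inside  ∷ outside ∷ X) (_       ∷ inside  ∷ Y) h with there () ← h (there here)
π-mono s (outside ∷ outside ∷ X) (outside ∷ inside  ∷ Y) h with there () ← h (there here)

parallel : IndependenceSystem n → Fin n → IndependenceSystem (2 + n)
parallel {n} F s = record
  { ground     = ground∘s
  ; Ind        = λ X → X ⊆ ground∘s × ∣ X ∩ ⁅s₁,s₂⁆ ∣ ≤ 1 × Ind F (π s X)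
  ; Ind?       = λ X → X ⊆? ground∘s ×-dec ∣ X ∩ ⁅s₁,s₂⁆ ∣ ≤? 1 ×-dec Ind? F (π s X)
  ; ind⊆ground = proj₁
  ; nonempty   = ⊥ , ⊥⊆
               , subst (_≤ 1) (sym (trans (cong ∣_∣ (∩-zeroˡ {2 + n} ⁅s₁,s₂⁆)) (∣⊥∣≡0 (2 + n)))) z≤n
               , empty-ind F
  ; closed     = λ {X} {Y} Y⊆X (X⊆ , ≤1 , indX) →
                 X⊆ ∘ Y⊆X
               , ≤-trans (p⊆q⇒∣p∣≤∣q∣ (∩-monoˡ ⁅s₁,s₂⁆ Y⊆X)) ≤1
               , closed F (π-mono s X Y Y⊆X) indX
  }
  where
  ground∘s : Subset (2 + n)
  ground∘s = inside ∷ inside ∷ (ground F - s)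

record IsCircuit (F : IndependenceSystem n) (C : Subset n) : Set where
  field
    ⊆ground   : C ⊆ ground F
    dependent : ¬ Ind F C
    minimal   : ∀ {D} → D ⊂ C → Ind F D

IsLoop : IndependenceSystem n → Fin n → Set
IsLoop F s = IsCircuit F ⁅ s ⁆

record IsBasis (F : IndependenceSystem n) (X P : Subset n) : Set where
  field
    ⊆X          : P ⊆ X
    independent : Ind F P
    maximal     : ∀ {Q} → Q ⊆ X → Ind F Q → P ⊆ Q → P ≡ Q

IsMatroid : IndependenceSystem n → Set
IsMatroid F = ∀ {I J} → Ind F I → Ind F J → ∣ I ∣ < ∣ J ∣ →
  ∃[ e ] e ∈ J × e ∉ I × Ind F (I ∪ ⁅ e ⁆)

IsMatroidIntersection : ℕ → IndependenceSystem n → Set₁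
IsMatroidIntersection {n} k F =
  Σ[ M ∈ (Fin k → IndependenceSystem n) ]
    (∀ i → IsMatroid (M i)) ×
    (∀ i → ground (M i) ≡ ground F) ×
    (∀ X → Ind F X ⇔ (∀ i → Ind (M i) X))

-- tabulate (λ i → lookup (ground (M i)) e) is the set of those i with e ∈ Sᵢ.
IsMatchoid : ℕ → IndependenceSystem n → Set₁
IsMatchoid {n} k F =
  ∃[ N ] Σ[ M ∈ (Fin N → IndependenceSystem n) ]
    (∀ i → IsMatroid (M i)) ×
    ground F ≡ ⋃ (List.tabulate (λ i → ground (M i))) ×
    (∀ {e} → e ∈ ground F → ∣ tabulate (λ i → lookup (ground (M i)) e) ∣ ≤ k) ×
    (∀ X → Ind F X ⇔ (X ⊆ ground F × (∀ i → Ind (M i) (X ∩ ground (M i)))))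

ContainsAtMostCircuits : ℕ → IndependenceSystem n → Subset n → Set
ContainsAtMostCircuits k F X =
  ∀ Cs → Unique Cs → All (λ C → IsCircuit F C × C ⊆ X) Cs → length Cs ≤ k

IsCircuitBounded : ℕ → IndependenceSystem n → Set
IsCircuitBounded k F = ∀ {I e} → Ind F I → e ∈ ground F → e ∉ I →
  ContainsAtMostCircuits k F (I ∪ ⁅ e ⁆)

-- The parts of a partition may be empty.
IsPartition : Subset n → Subset n → Subset n → Set
IsPartition Q Z X = Q ∪ Z ≡ X × Q ∩ Z ≡ ⊥

IsGrowth : ℕ → IndependenceSystem n → Set
IsGrowth k F = ∀ {X I} → X ⊆ ground F → Ind F I →
  ∃[ Q ] ∃[ Z ] IsPartition Q Z (I ─ X) ×
    ∣ Z ∣ ≤ k * ∣ X ─ I ∣ ×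
    (∀ {P} → IsBasis F X P → Ind F (P ∪ Q))

IsExtendible : ℕ → IndependenceSystem n → Set
IsExtendible k F = ∀ {A B e} → A ⊆ B → Ind F B →
  e ∈ ground F → e ∉ B → Ind F (A ∪ ⁅ e ⁆) →
  ∃[ Z ] Z ⊆ B ─ A × ∣ Z ∣ ≤ k × Ind F ((B ∪ ⁅ e ⁆) ─ Z)

ClosedUnderOperations : ∀ {ℓ} → (∀ {n} → IndependenceSystem n → Set ℓ) → Set (lsuc lzero ⊔ ℓ)
ClosedUnderOperations 𝓒 = ∀ {n} (F : IndependenceSystem n) → 𝓒 F →
  (∀ {s} → s ∈ ground F → ¬ IsLoop F s → 𝓒 (parallel F s)) ×
  (∀ {Y} → Y ⊆ ground F → 𝓒 (restrict F Y)) ×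
  (∀ {I} (indI : Ind F I) → 𝓒 (contract F I indI))

{-# OPTIONS --safe #-}
module Submission where

-- Let ρ send s₁ and s₂ to s and fix the other elements, so that π s X is the image of X
-- under ρ.  A subset X of the ground set of the parallel extension is independent if and
-- only if ρ is injective on X and its image is independent in F.  Hence each property of
-- F lifts along ρ by taking images and preimages; an element y with ρ y ∈ ρ(I) for an
-- independent I is parallel to a unique z ∈ I and can replace it, and it costs one
-- circuit or one deleted element, which is where k ≥ 1 enters.  A circuit C of F / I
-- comes from a circuit D of F with C = D ∖ I.

open import Data.Fin using (Fin; zero; suc)
open import Data.Fin.Properties using (any?; suc-injective)
open import Data.Fin.Subset
open import Data.Fin.Subset.Induction using (⊂-wellFounded)
open import Data.Fin.Subset.Properties
open import Data.List using ([]; _∷_; map)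
import Data.List as List
open import Data.List.Properties using (length-map)
open import Data.List.Relation.Unary.All using (All; []; _∷_)
open import Data.List.Relation.Unary.AllPairs using (_∷_)
open import Data.List.Relation.Unary.Unique.Propositional.Properties using (map⁻)
open import Data.Nat using (ℕ; _+_; _*_; _≤_; _<_; z≤n; s≤s; >-nonZero)
open import Data.Nat.Properties hiding (suc-injective)
open import Data.Product using (∃-syntax; _×_; _,_; proj₁; proj₂)
open import Data.Sum using (_⊎_; inj₁; inj₂; [_,_]′) renaming (map to ⊎-map)
open import Data.Vec using ([]; _∷_; here; there; lookup; tabulate)
open import Data.Vec.Properties using ([]=⇒lookup; lookup⇒[]=; lookup∘tabulate)
open import Function using (_∘_; id; _⇔_; mk⇔; Equivalence)
open import Induction.WellFounded using (Acc; acc)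
open import Relation.Binary.PropositionalEquality
  using (_≡_; _≢_; refl; sym; trans; cong; subst; subst₂)
open import Relation.Nullary using (¬_; yes; no; contradiction)
open import Relation.Nullary.Decidable using (_×-dec_; ¬?; decidable-stable)
open import Defs

open IndependenceSystem
open IsCircuit
open IsBasis
open Equivalence using (to; from)

private
  variable
    m n : ℕ

-- Finite subsets: differences, cardinalities, preimages and indexed unions

∪-lub : {p q r : Subset n} → p ⊆ r → q ⊆ r → p ∪ q ⊆ r
∪-lub {p = p} {q} p⊆r q⊆r x∈ = [ p⊆r , q⊆r ]′ (x∈p∪q⁻ p q x∈)

∪-monoʳ : ∀ {p q : Subset n} r → p ⊆ q → r ∪ p ⊆ r ∪ q
∪-monoʳ {q = q} r p⊆q = ∪-lub (p⊆p∪q q) (q⊆p∪q r q ∘ p⊆q)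

⁅x⁆⊆p : ∀ {x} {p : Subset n} → x ∈ p → ⁅ x ⁆ ⊆ p
⁅x⁆⊆p {x = x} x∈p y∈ with refl ← x∈⁅y⁆⇒x≡y x y∈ = x∈p

x∈p∪⁅x⁆ : ∀ (p : Subset n) x → x ∈ p ∪ ⁅ x ⁆
x∈p∪⁅x⁆ p x = q⊆p∪q p ⁅ x ⁆ (x∈⁅x⁆ x)

x∈p∪⁅y⁆⁻ : ∀ (p : Subset n) {x y} → x ∈ p ∪ ⁅ y ⁆ → x ∈ p ⊎ x ≡ y
x∈p∪⁅y⁆⁻ p {y = y} = ⊎-map id (x∈⁅y⁆⇒x≡y y) ∘ x∈p∪q⁻ p ⁅ y ⁆

x∈p─q⁻ : ∀ (p q : Subset n) {x} → x ∈ p ─ q → x ∈ p × x ∉ q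
x∈p─q⁻ p q x∈ = p─q⊆p p q x∈ , x∉q p q x∈
  where
  x∉q : ∀ {n} (p q : Subset n) {x} → x ∈ p ─ q → x ∉ q
  x∉q (_ ∷ p) (_ ∷ q) (there x∈) (there x∈q) = x∉q p q x∈ x∈q
  x∉q (_ ∷ p) (_ ∷ q) ()         here

─-isPartition : ∀ {p q : Subset n} → q ⊆ p → IsPartition q (p ─ q) p
─-isPartition {p = p} {q} q⊆p =
  ⊆-antisym (∪-lub q⊆p (p─q⊆p p q)) p⊆ , Empty-unique empty
  where
  p⊆ : p ⊆ q ∪ (p ─ q)
  p⊆ {x} x∈p with x ∈? q
  ... | yes x∈q = p⊆p∪q (p ─ q) x∈q
  ... | no  x∉q = q⊆p∪q q (p ─ q) (x∈p∧x∉q⇒x∈p─q x∈p x∉q)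
  empty : Empty (q ∩ (p ─ q))
  empty (x , x∈) with x∈q , x∈p─q ← x∈p∩q⁻ q (p ─ q) x∈ = proj₂ (x∈p─q⁻ p q x∈p─q) x∈q

∣p∪q∣≤∣p∣+∣q∣ : ∀ (p q : Subset n) → ∣ p ∪ q ∣ ≤ ∣ p ∣ + ∣ q ∣
∣p∪q∣≤∣p∣+∣q∣ []            []            = z≤n
∣p∪q∣≤∣p∣+∣q∣ (outside ∷ p) (outside ∷ q) = ∣p∪q∣≤∣p∣+∣q∣ p q
∣p∪q∣≤∣p∣+∣q∣ (outside ∷ p) (inside  ∷ q) =
  ≤-trans (s≤s (∣p∪q∣≤∣p∣+∣q∣ p q)) (≤-reflexive (sym (+-suc ∣ p ∣ ∣ q ∣)))
∣p∪q∣≤∣p∣+∣q∣ (inside  ∷ p) (t       ∷ q) =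
  s≤s (≤-trans (∣p∪q∣≤∣p∣+∣q∣ p q) (+-monoʳ-≤ ∣ p ∣ (∣p∣≤∣x∷p∣ t q)))

disjoint⇒∣p∣+∣q∣≤∣r∣ : ∀ (p q r : Subset n) → p ⊆ r → q ⊆ r → (∀ {x} → x ∈ p → x ∉ q) →
  ∣ p ∣ + ∣ q ∣ ≤ ∣ r ∣
disjoint⇒∣p∣+∣q∣≤∣r∣ []            []            []            _   _   _    = z≤n
disjoint⇒∣p∣+∣q∣≤∣r∣ (inside  ∷ p) (inside  ∷ q) (_       ∷ r) p⊆r q⊆r p∩q =
  contradiction here (p∩q here)
disjoint⇒∣p∣+∣q∣≤∣r∣ (inside  ∷ p) (outside ∷ q) (t       ∷ r) p⊆r q⊆r p∩q with here ← p⊆r here =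
  s≤s (disjoint⇒∣p∣+∣q∣≤∣r∣ p q r (drop-∷-⊆ p⊆r) (drop-∷-⊆ q⊆r) (λ x∈p → p∩q (there x∈p) ∘ there))
disjoint⇒∣p∣+∣q∣≤∣r∣ (outside ∷ p) (inside  ∷ q) (t       ∷ r) p⊆r q⊆r p∩q with here ← q⊆r here =
  ≤-trans (≤-reflexive (+-suc ∣ p ∣ ∣ q ∣))
    (s≤s (disjoint⇒∣p∣+∣q∣≤∣r∣ p q r (drop-∷-⊆ p⊆r) (drop-∷-⊆ q⊆r) (λ x∈p → p∩q (there x∈p) ∘ there)))
disjoint⇒∣p∣+∣q∣≤∣r∣ (outside ∷ p) (outside ∷ q) (t       ∷ r) p⊆r q⊆r p∩q =
  ≤-trans (disjoint⇒∣p∣+∣q∣≤∣r∣ p q r (drop-∷-⊆ p⊆r) (drop-∷-⊆ q⊆r) (λ x∈p → p∩q (there x∈p) ∘ there))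
    (∣p∣≤∣x∷p∣ t r)

InjectiveOn : (Fin m → Fin n) → Subset m → Set
InjectiveOn f p = ∀ {x y} → x ∈ p → y ∈ p → f x ≡ f y → x ≡ y

injectiveOn-⊆ : ∀ {f : Fin m → Fin n} {p q} → p ⊆ q → InjectiveOn f q → InjectiveOn f p
injectiveOn-⊆ p⊆q inj x∈p y∈p = inj (p⊆q x∈p) (p⊆q y∈p)

-- Induction on `p`. When the first element belongs to `p`, its value is deleted from `q`;
-- injectivity keeps the remaining values inside the smaller target.
injectiveOn⇒∣p∣≤∣q∣ : ∀ (f : Fin m → Fin n) (p : Subset m) {q} →
  InjectiveOn f p → (∀ {x} → x ∈ p → f x ∈ q) → ∣ p ∣ ≤ ∣ q ∣
injectiveOn⇒∣p∣≤∣q∣ f []            inj f∈ = z≤n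
injectiveOn⇒∣p∣≤∣q∣ f (outside ∷ p) inj f∈ =
  injectiveOn⇒∣p∣≤∣q∣ (f ∘ suc) p
    (λ x∈p y∈p eq → suc-injective (inj (there x∈p) (there y∈p) eq)) (f∈ ∘ there)
injectiveOn⇒∣p∣≤∣q∣ f (inside  ∷ p) inj f∈ =
  ≤-trans
    (s≤s (injectiveOn⇒∣p∣≤∣q∣ (f ∘ suc) p
      (λ x∈p y∈p eq → suc-injective (inj (there x∈p) (there y∈p) eq))
      (λ x∈p → x∈p∧x≢y⇒x∈p-y (f∈ (there x∈p)) (λ eq → contradiction (inj (there x∈p) here eq) λ ()))))
    (x∈p⇒∣p-x∣<∣p∣ (f∈ here))

∈-tabulate⁺ : ∀ (f : Fin n → Side) {i} → f i ≡ inside → i ∈ tabulate f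
∈-tabulate⁺ f {i} eq = lookup⇒[]= i (tabulate f) (trans (lookup∘tabulate f i) eq)

∈-tabulate⁻ : ∀ (f : Fin n → Side) {i} → i ∈ tabulate f → f i ≡ inside
∈-tabulate⁻ f {i} i∈ = trans (sym (lookup∘tabulate f i)) ([]=⇒lookup i∈)

preimage : (Fin m → Fin n) → Subset n → Subset m
preimage f p = tabulate (lookup p ∘ f)

∈-preimage⁺ : ∀ (f : Fin m → Fin n) (p : Subset n) {x} → f x ∈ p → x ∈ preimage f p
∈-preimage⁺ f p = ∈-tabulate⁺ (lookup p ∘ f) ∘ []=⇒lookup

∈-preimage⁻ : ∀ (f : Fin m → Fin n) (p : Subset n) {x} → x ∈ preimage f p → f x ∈ p
∈-preimage⁻ f p {x} = lookup⇒[]= (f x) p ∘ ∈-tabulate⁻ (lookup p ∘ f)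

∈-⋃-tabulate⁺ : ∀ {N} (p : Fin N → Subset n) i {x} → x ∈ p i → x ∈ ⋃ (List.tabulate p)
∈-⋃-tabulate⁺ p zero    x∈ = p⊆p∪q (⋃ (List.tabulate (p ∘ suc))) x∈
∈-⋃-tabulate⁺ p (suc i) x∈ = q⊆p∪q (p zero) _ (∈-⋃-tabulate⁺ (p ∘ suc) i x∈)

∈-⋃-tabulate⁻ : ∀ {N} (p : Fin N → Subset n) {x} → x ∈ ⋃ (List.tabulate p) → ∃[ i ] x ∈ p i
∈-⋃-tabulate⁻ {N = ℕ.zero}  p x∈ = contradiction x∈ ∉⊥
∈-⋃-tabulate⁻ {N = ℕ.suc N} p x∈ with x∈p∪q⁻ (p zero) _ x∈
... | inj₁ x∈p₀ = zero , x∈p₀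
... | inj₂ x∈⋃  with i , x∈pᵢ ← ∈-⋃-tabulate⁻ (p ∘ suc) x∈⋃ = suc i , x∈pᵢ

∪-ind-swap : ∀ (F : IndependenceSystem n) (X Y Z : Subset n) →
  Ind F ((X ∪ Y) ∪ Z) → Ind F ((X ∪ Z) ∪ Y)
∪-ind-swap F X Y Z = subst (Ind F)
  (trans (∪-assoc X Y Z) (trans (cong (X ∪_) (∪-comm Y Z)) (sym (∪-assoc X Z Y))))

-- Parallel extensions

ρ : Fin n → Fin (2 + n) → Fin n
ρ s zero          = s
ρ s (suc zero)    = s
ρ s (suc (suc x)) = x

module _ (s : Fin n) where

  ∈-π⁺ : ∀ (X : Subset (2 + n)) {x} → x ∈ X → ρ s x ∈ π s X
  ∈-π⁺ (inside  ∷ outside ∷ X) here               = x∈p∪⁅x⁆ X s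
  ∈-π⁺ (inside  ∷ inside  ∷ X) here               = x∈p∪⁅x⁆ X s
  ∈-π⁺ (outside ∷ inside  ∷ X) (there here)       = x∈p∪⁅x⁆ X s
  ∈-π⁺ (inside  ∷ inside  ∷ X) (there here)       = x∈p∪⁅x⁆ X s
  ∈-π⁺ (outside ∷ outside ∷ X) (there (there x∈)) = x∈
  ∈-π⁺ (inside  ∷ outside ∷ X) (there (there x∈)) = p⊆p∪q ⁅ s ⁆ x∈
  ∈-π⁺ (outside ∷ inside  ∷ X) (there (there x∈)) = p⊆p∪q ⁅ s ⁆ x∈
  ∈-π⁺ (inside  ∷ inside  ∷ X) (there (there x∈)) = p⊆p∪q ⁅ s ⁆ x∈

  ∈-π⁻ : ∀ (X : Subset (2 + n)) {e} → e ∈ π s X → ∃[ x ] x ∈ X × ρ s x ≡ e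
  ∈-π⁻ (outside ∷ outside ∷ X) e∈ = _ , there (there e∈) , refl
  ∈-π⁻ (inside  ∷ outside ∷ X) e∈ with x∈p∪⁅y⁆⁻ X e∈
  ... | inj₁ e∈X  = _ , there (there e∈X) , refl
  ... | inj₂ refl = s₁ , here , refl
  ∈-π⁻ (outside ∷ inside  ∷ X) e∈ with x∈p∪⁅y⁆⁻ X e∈
  ... | inj₁ e∈X  = _ , there (there e∈X) , refl
  ... | inj₂ refl = s₂ , there here , refl
  ∈-π⁻ (inside  ∷ inside  ∷ X) e∈ with x∈p∪⁅y⁆⁻ X e∈
  ... | inj₁ e∈X  = _ , there (there e∈X) , refl
  ... | inj₂ refl = s₁ , here , refl

  π-least : ∀ (X : Subset (2 + n)) {D} → (∀ {x} → x ∈ X → ρ s x ∈ D) → π s X ⊆ D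
  π-least X ρ∈D e∈ with _ , x∈X , refl ← ∈-π⁻ X e∈ = ρ∈D x∈X

  π-∪⊆ : ∀ (X Y : Subset (2 + n)) → π s (X ∪ Y) ⊆ π s X ∪ π s Y
  π-∪⊆ X Y = π-least (X ∪ Y) λ x∈ →
    x∈p∪q⁺ (⊎-map (∈-π⁺ X) (∈-π⁺ Y) (x∈p∪q⁻ X Y x∈))

  π-∪⁅⁆⊆ : ∀ (X : Subset (2 + n)) y → π s (X ∪ ⁅ y ⁆) ⊆ π s X ∪ ⁅ ρ s y ⁆
  π-∪⁅⁆⊆ X y = π-least (X ∪ ⁅ y ⁆) (ρ∈ ∘ x∈p∪⁅y⁆⁻ X)
    where
    ρ∈ : ∀ {x} → x ∈ X ⊎ x ≡ y → ρ s x ∈ π s X ∪ ⁅ ρ s y ⁆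
    ρ∈ (inj₁ x∈X)  = p⊆p∪q ⁅ ρ s y ⁆ (∈-π⁺ X x∈X)
    ρ∈ (inj₂ refl) = x∈p∪⁅x⁆ (π s X) (ρ s y)

  injectiveOn-∪⁅⁆ : ∀ {X : Subset (2 + n)} {y} →
    InjectiveOn (ρ s) X → ρ s y ∉ π s X → InjectiveOn (ρ s) (X ∪ ⁅ y ⁆)
  injectiveOn-∪⁅⁆ {X} {y} inj ρy∉ {v} {w} v∈ w∈ eq with x∈p∪⁅y⁆⁻ X v∈ | x∈p∪⁅y⁆⁻ X w∈
  ... | inj₁ v∈X  | inj₁ w∈X  = inj v∈X w∈X eq
  ... | inj₁ v∈X  | inj₂ refl = contradiction (subst (_∈ π s X) eq (∈-π⁺ X v∈X)) ρy∉
  ... | inj₂ refl | inj₁ w∈X  = contradiction (subst (_∈ π s X) (sym eq) (∈-π⁺ X w∈X)) ρy∉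
  ... | inj₂ refl | inj₂ refl = refl

  ∣π∣≤ : ∀ (X : Subset (2 + n)) → ∣ π s X ∣ ≤ ∣ X ∣
  ∣π∣≤ (outside ∷ outside ∷ X) = ≤-refl
  ∣π∣≤ (inside  ∷ outside ∷ X) = ∣p∪⁅x⁆∣≤ X
    where
    ∣p∪⁅x⁆∣≤ : ∀ p → ∣ p ∪ ⁅ s ⁆ ∣ ≤ 1 + ∣ p ∣
    ∣p∪⁅x⁆∣≤ p = ≤-trans (∣p∪q∣≤∣p∣+∣q∣ p ⁅ s ⁆)
      (≤-reflexive (trans (cong (∣ p ∣ +_) (∣⁅x⁆∣≡1 s)) (+-comm ∣ p ∣ 1)))
  ∣π∣≤ (outside ∷ inside  ∷ X) = ∣π∣≤ (inside ∷ outside ∷ X)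
  ∣π∣≤ (inside  ∷ inside  ∷ X) = m≤n⇒m≤1+n (∣π∣≤ (inside ∷ outside ∷ X))

  injectiveOn⇒∣π∣≡ : ∀ {X : Subset (2 + n)} → InjectiveOn (ρ s) X → ∣ π s X ∣ ≡ ∣ X ∣
  injectiveOn⇒∣π∣≡ {X} inj = ≤-antisym (∣π∣≤ X) (injectiveOn⇒∣p∣≤∣q∣ (ρ s) X inj (∈-π⁺ X))

  -- Together with `π-∩-preimage⊆`, this makes `D` the exact image of `X ∩ preimage (ρ s) D`, which
  -- is how subsets of an image are pulled back into `X`.
  ⊆-π-∩-preimage : ∀ (X : Subset (2 + n)) {D} → D ⊆ π s X → D ⊆ π s (X ∩ preimage (ρ s) D)
  ⊆-π-∩-preimage X {D} D⊆ e∈D with _ , x∈X , refl ← ∈-π⁻ X (D⊆ e∈D) =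
    ∈-π⁺ (X ∩ preimage (ρ s) D) (x∈p∩q⁺ (x∈X , ∈-preimage⁺ (ρ s) D e∈D))

  π-∩-preimage⊆ : ∀ (X : Subset (2 + n)) D → π s (X ∩ preimage (ρ s) D) ⊆ D
  π-∩-preimage⊆ X D =
    π-least (X ∩ preimage (ρ s) D) (∈-preimage⁻ (ρ s) D ∘ p∩q⊆q X (preimage (ρ s) D))

  module _ (F : IndependenceSystem n) where

    private
      F∘s = parallel F s

    ∈-ground∘⁺ : ∀ {x} → ρ s x ∈ ground F → x ≢ suc (suc s) → x ∈ ground F∘s
    ∈-ground∘⁺ {zero}        _  _  = here
    ∈-ground∘⁺ {suc zero}    _  _  = there here
    ∈-ground∘⁺ {suc (suc x)} x∈ x≢ =
      there (there (x∈p∧x≢y⇒x∈p-y x∈ (x≢ ∘ cong (suc ∘ suc))))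

    ∈-ground∘⇒≢ : ∀ {x} → x ∈ ground F∘s → x ≢ suc (suc s)
    ∈-ground∘⇒≢ (there (there s∈)) refl = proj₂ (x∈p─q⁻ (ground F) ⁅ s ⁆ s∈) (x∈⁅x⁆ s)

    ∈-ground∘⁻ : s ∈ ground F → ∀ {x} → x ∈ ground F∘s → ρ s x ∈ ground F
    ∈-ground∘⁻ s∈ here               = s∈
    ∈-ground∘⁻ s∈ (there here)       = s∈
    ∈-ground∘⁻ s∈ (there (there x∈)) = p─q⊆p (ground F) ⁅ s ⁆ x∈

    -- X contains at most one of s₁, s₂ precisely if ρ s is injective on X,
    -- because s itself is not in the ground set.
    parallel-ind⁺ : ∀ {X} → X ⊆ ground F∘s → InjectiveOn (ρ s) X → Ind F (π s X) → Ind F∘s X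
    parallel-ind⁺ {X} X⊆ inj ind = (λ {x} → X⊆ {x}) , ≤1 , ind
      where
      ρ∈⁅s⁆ : ∀ {x} → x ∈ ⁅s₁,s₂⁆ → ρ s x ∈ ⁅ s ⁆
      ρ∈⁅s⁆ x∈ with x∈p∪⁅y⁆⁻ ⁅ s₁ ⁆ {y = s₂} x∈
      ... | inj₂ refl = x∈⁅x⁆ s
      ... | inj₁ x∈₁ with refl ← x∈⁅y⁆⇒x≡y s₁ x∈₁ = x∈⁅x⁆ s
      ≤1 : ∣ X ∩ ⁅s₁,s₂⁆ ∣ ≤ 1
      ≤1 = ≤-trans
        (injectiveOn⇒∣p∣≤∣q∣ (ρ s) (X ∩ ⁅s₁,s₂⁆)
          (injectiveOn-⊆ {p = X ∩ ⁅s₁,s₂⁆} (p∩q⊆p X ⁅s₁,s₂⁆) inj) (ρ∈⁅s⁆ ∘ p∩q⊆q X ⁅s₁,s₂⁆))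
        (≤-reflexive (∣⁅x⁆∣≡1 s))

    parallel-injective : ∀ {X} → Ind F∘s X → InjectiveOn (ρ s) X
    parallel-injective (X⊆ , ≤1 , _) here               here               _    = refl
    -- With both `s₁` and `s₂` in `X`, the intersection with `⁅s₁,s₂⁆` has at least two elements.
    -- The remaining clashes below involve the old copy of `s`, which is outside the ground set.
    parallel-injective (X⊆ , s≤s () , _) here           (there here)       _
    parallel-injective (X⊆ , ≤1 , _) here               y∈@(there (there _)) refl =
      contradiction refl (∈-ground∘⇒≢ (X⊆ y∈))
    parallel-injective (X⊆ , s≤s () , _) (there here)   here               _
    parallel-injective (X⊆ , ≤1 , _) (there here)       (there here)       _    = refl
    parallel-injective (X⊆ , ≤1 , _) (there here)       y∈@(there (there _)) refl =
      contradiction refl (∈-ground∘⇒≢ (X⊆ y∈))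
    parallel-injective (X⊆ , ≤1 , _) x∈@(there (there _)) here             refl =
      contradiction refl (∈-ground∘⇒≢ (X⊆ x∈))
    parallel-injective (X⊆ , ≤1 , _) x∈@(there (there _)) (there here)     refl =
      contradiction refl (∈-ground∘⇒≢ (X⊆ x∈))
    parallel-injective (X⊆ , ≤1 , _) (there (there _))  (there (there _))  refl = refl

    parallel-π-ind : ∀ {X} → Ind F∘s X → Ind F (π s X)
    parallel-π-ind (_ , _ , ind) = ind

    -- As `ρ s y` is new to the image, adding `y` keeps `ρ s` injective. This is how elements found
    -- in `F` are carried back to the parallel extension, in the exchange property and for bases.
    parallel-insert : ∀ {X y} → Ind F∘s X → y ∈ ground F∘s → ρ s y ∉ π s X →
      Ind F (π s X ∪ ⁅ ρ s y ⁆) → Ind F∘s (X ∪ ⁅ y ⁆)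
    parallel-insert {X} {y} indX y∈ ρy∉ ind = parallel-ind⁺
      (∪-lub (ind⊆ground F∘s indX) (⁅x⁆⊆p y∈))
      (injectiveOn-∪⁅⁆ (parallel-injective indX) ρy∉)
      (closed F (π-∪⁅⁆⊆ X y) ind)

    -- If y is parallel to z ∈ X, then exchanging z for y does not change the image.
    parallel-swap : ∀ {X y z} → Ind F∘s X → y ∈ ground F∘s → z ∈ X → ρ s y ≡ ρ s z →
      Ind F∘s ((X ∪ ⁅ y ⁆) - z)
    parallel-swap {X} {y} {z} indX y∈ z∈X ρy≡ρz = parallel-ind⁺
      (∪-lub (ind⊆ground F∘s indX) (⁅x⁆⊆p y∈) ∘ p─q⊆p (X ∪ ⁅ y ⁆) ⁅ z ⁆)
      inj′
      (closed F (π-least ((X ∪ ⁅ y ⁆) - z) (ρ∈ ∘ split)) (parallel-π-ind indX))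
      where
      inj = parallel-injective indX
      split : ∀ {x} → x ∈ (X ∪ ⁅ y ⁆) - z → (x ∈ X × x ≢ z) ⊎ x ≡ y
      split x∈ with x∈∪ , x∉⁅z⁆ ← x∈p─q⁻ (X ∪ ⁅ y ⁆) ⁅ z ⁆ x∈ | x∈p∪⁅y⁆⁻ X x∈∪
      ... | inj₁ x∈X = inj₁ (x∈X , x∉⁅y⁆⇒x≢y x∉⁅z⁆)
      ... | inj₂ x≡y = inj₂ x≡y
      ρ∈ : ∀ {x} → (x ∈ X × x ≢ z) ⊎ x ≡ y → ρ s x ∈ π s X
      ρ∈ (inj₁ (x∈X , _)) = ∈-π⁺ X x∈X
      ρ∈ (inj₂ refl)      = subst (_∈ π s X) (sym ρy≡ρz) (∈-π⁺ X z∈X)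
      inj′ : InjectiveOn (ρ s) ((X ∪ ⁅ y ⁆) - z)
      inj′ v∈ w∈ eq with split v∈ | split w∈
      ... | inj₁ (v∈X , _)   | inj₁ (w∈X , _)   = inj v∈X w∈X eq
      ... | inj₁ (v∈X , v≢z) | inj₂ refl        = contradiction (inj v∈X z∈X (trans eq ρy≡ρz)) v≢z
      ... | inj₂ refl        | inj₁ (w∈X , w≢z) = contradiction (inj w∈X z∈X (trans (sym eq) ρy≡ρz)) w≢z
      ... | inj₂ refl        | inj₂ refl        = refl

-- Matroid intersections

restrict-isMatroid : ∀ (M : IndependenceSystem n) Y → IsMatroid M → IsMatroid (restrict M Y)
restrict-isMatroid M Y exchange (I⊆Y , indI) (J⊆Y , indJ) I<J
  with e , e∈J , e∉I , ind ← exchange indI indJ I<J =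
  e , e∈J , e∉I , ∪-lub I⊆Y (⁅x⁆⊆p (J⊆Y e∈J)) , ind

-- Exchange in `M` is applied to `I ∪ K` and `J ∪ K`. Since `J` is disjoint from `K`, the strict
-- inequality of sizes survives adding `K`, and the element obtained, being outside `I ∪ K`, must
-- come from `J`.
contract-isMatroid : ∀ (M : IndependenceSystem n) {K} (indK : Ind M K) →
  IsMatroid M → IsMatroid (contract M K indK)
contract-isMatroid M {K} indK exchange {I} {J} (I⊆ , indI) (J⊆ , indJ) I<J =
  let e , e∈J∪K , e∉I∪K , ind = exchange indI indJ ∣I∪K∣<∣J∪K∣
      e∈J = x∈J (x∈p∪q⁻ J K e∈J∪K) e∉I∪K
  in e , e∈J , e∉I∪K ∘ p⊆p∪q K , ∪-lub I⊆ (⁅x⁆⊆p (J⊆ e∈J)) , ∪-ind-swap M I K ⁅ e ⁆ ind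
  where
  x∈J : ∀ {x} → x ∈ J ⊎ x ∈ K → x ∉ I ∪ K → x ∈ J
  x∈J (inj₁ x∈J) _  = x∈J
  x∈J (inj₂ x∈K) x∉ = contradiction (q⊆p∪q I K x∈K) x∉
  ∣I∪K∣<∣J∪K∣ : ∣ I ∪ K ∣ < ∣ J ∪ K ∣
  ∣I∪K∣<∣J∪K∣ = ≤-trans (s≤s (∣p∪q∣≤∣p∣+∣q∣ I K)) (≤-trans (+-monoˡ-< ∣ K ∣ I<J)
    (disjoint⇒∣p∣+∣q∣≤∣r∣ J K (J ∪ K) (p⊆p∪q K) (q⊆p∪q J K)
      (proj₂ ∘ x∈p─q⁻ (ground M) K ∘ J⊆)))

-- Independent sets have the same size as their images, so exchange applies to the images, and the
-- element it yields is the image of some `y ∈ J`.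
parallel-isMatroid : ∀ (M : IndependenceSystem n) s → IsMatroid M → IsMatroid (parallel M s)
parallel-isMatroid M s exchange {I} {J} indI indJ I<J
  with e , e∈πJ , e∉πI , ind ← exchange (parallel-π-ind s M indI) (parallel-π-ind s M indJ)
         (subst₂ _<_ (sym (injectiveOn⇒∣π∣≡ s (parallel-injective s M indI)))
                     (sym (injectiveOn⇒∣π∣≡ s (parallel-injective s M indJ))) I<J)
  with y , y∈J , refl ← ∈-π⁻ s J e∈πJ =
  y , y∈J , e∉πI ∘ ∈-π⁺ s I
    , parallel-insert s M indI (ind⊆ground (parallel M s) indJ y∈J) e∉πI ind

matroidIntersection-closed : ∀ {k} → 1 ≤ k → ClosedUnderOperations (IsMatroidIntersection k)
-- Matching on `1 ≤ k` makes `k` a successor, so that `M zero` exists. The converse directions below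
-- read off from it that `X` lies in the ground set and, for the parallel extension, that `ρ s` is
-- injective on `X`.
matroidIntersection-closed {k} (s≤s _) {n} F (M , exchange , ground≡ , Ind⇔) =
    (λ {s} _ _ → (λ i → parallel (M i) s)
      , (λ i → parallel-isMatroid (M i) s (exchange i))
      , (λ i → cong (λ S → inside ∷ inside ∷ (S - s)) (ground≡ i))
      , λ X → mk⇔
          (λ indX i → parallel-ind⁺ s (M i)
            (λ {x} x∈ → subst (λ S → x ∈ inside ∷ inside ∷ (S - s)) (sym (ground≡ i))
                          (ind⊆ground (parallel F s) indX x∈))
            (parallel-injective s F indX)
            (to (Ind⇔ (π s X)) (parallel-π-ind s F indX) i))
          (λ indX → parallel-ind⁺ s F
            (λ {x} x∈ → subst (λ S → x ∈ inside ∷ inside ∷ (S - s)) (ground≡ zero)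
                          (ind⊆ground (parallel (M zero) s) (indX zero) x∈))
            (parallel-injective s (M zero) (indX zero))
            (from (Ind⇔ (π s X)) (λ i → parallel-π-ind s (M i) (indX i)))))
  , (λ {Y} _ → (λ i → restrict (M i) Y)
      , (λ i → restrict-isMatroid (M i) Y (exchange i))
      , (λ _ → refl)
      , λ X → mk⇔
          (λ (X⊆Y , indX) i → (λ {x} → X⊆Y {x}) , to (Ind⇔ X) indX i)
          (λ indX → (λ {x} → proj₁ (indX zero) {x}) , from (Ind⇔ X) (proj₂ ∘ indX)))
  , (λ {K} indK → (λ i → contract (M i) K (to (Ind⇔ K) indK i))
      , (λ i → contract-isMatroid (M i) (to (Ind⇔ K) indK i) (exchange i))
      , (λ i → cong (_─ K) (ground≡ i))
      , λ X → mk⇔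
          (λ (X⊆ , indX) i → (λ {x} x∈ → subst (λ S → x ∈ S ─ K) (sym (ground≡ i)) (X⊆ x∈))
                           , to (Ind⇔ (X ∪ K)) indX i)
          (λ indX → (λ {x} x∈ → subst (λ S → x ∈ S ─ K) (ground≡ zero) (proj₁ (indX zero) x∈))
                  , from (Ind⇔ (X ∪ K)) (proj₂ ∘ indX)))

-- Matchoids

-- The i-th matroid of the new representation has ground set f⁻¹(Sᵢ) ∩ ground G, so an
-- element x lies in as many of these sets as f x does in the sets Sᵢ.
matchoid-pullback : ∀ {k N} (F : IndependenceSystem n) (G : IndependenceSystem m)
  (M : Fin N → IndependenceSystem n) (M′ : Fin N → IndependenceSystem m) (f : Fin m → Fin n) →
  ground F ≡ ⋃ (List.tabulate (λ i → ground (M i))) →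
  (∀ {e} → e ∈ ground F → ∣ tabulate (λ i → lookup (ground (M i)) e) ∣ ≤ k) →
  (∀ {x} → x ∈ ground G → f x ∈ ground F) →
  (∀ i → IsMatroid (M′ i)) →
  (∀ X → X ⊆ ground G → Ind G X ⇔ (∀ i → Ind (M′ i) (X ∩ preimage f (ground (M i))))) →
  IsMatchoid k G
matchoid-pullback {m = m} {N = N} F G M M′ f ground≡ count f∈ exchange Ind⇔ =
  N , (λ i → restrict (M′ i) (S i)) , (λ i → restrict-isMatroid (M′ i) (S i) (exchange i))
    , ⊆-antisym ⊆⋃ ⋃⊆
    , (λ {x} x∈ → ≤-trans (p⊆q⇒∣p∣≤∣q∣ (λ {i} → indices⊆ x {i})) (count (f∈ x∈)))
    , λ X → mk⇔
        (λ indX → (λ {x} → ind⊆ground G indX {x}) , λ i →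
            (λ {x} → p∩q⊆q X (S i) {x})
          , closed (M′ i) (∩-S⊆ X i) (to (Ind⇔ X (ind⊆ground G indX)) indX i))
        (λ (X⊆ , indX) → from (Ind⇔ X X⊆) λ i → closed (M′ i) (⊆∩-S X i X⊆) (proj₂ (indX i)))
  where
  S : Fin N → Subset m
  S i = preimage f (ground (M i)) ∩ ground G
  ∈-S⁺ : ∀ i {x} → f x ∈ ground (M i) → x ∈ ground G → x ∈ S i
  ∈-S⁺ i fx∈ x∈ = x∈p∩q⁺ (∈-preimage⁺ f (ground (M i)) fx∈ , x∈)
  ∈-S⁻ : ∀ i {x} → x ∈ S i → f x ∈ ground (M i) × x ∈ ground G
  ∈-S⁻ i x∈ with x∈f⁻¹ , x∈G ← x∈p∩q⁻ (preimage f (ground (M i))) (ground G) x∈ =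
    ∈-preimage⁻ f (ground (M i)) x∈f⁻¹ , x∈G
  ⊆⋃ : ground G ⊆ ⋃ (List.tabulate S)
  ⊆⋃ {x} x∈ with i , fx∈ ← ∈-⋃-tabulate⁻ (λ i → ground (M i)) (subst (f x ∈_) ground≡ (f∈ x∈)) =
    ∈-⋃-tabulate⁺ S i (∈-S⁺ i fx∈ x∈)
  ⋃⊆ : ⋃ (List.tabulate S) ⊆ ground G
  ⋃⊆ x∈ with i , x∈Sᵢ ← ∈-⋃-tabulate⁻ S x∈ = proj₂ (∈-S⁻ i x∈Sᵢ)
  indices⊆ : ∀ x → tabulate (λ i → lookup (S i) x) ⊆ tabulate (λ i → lookup (ground (M i)) (f x))
  indices⊆ x {i} i∈ = ∈-tabulate⁺ (λ i → lookup (ground (M i)) (f x)) ([]=⇒lookup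
    (proj₁ (∈-S⁻ i (lookup⇒[]= x (S i) (∈-tabulate⁻ (λ i → lookup (S i) x) i∈)))))
  ∩-S⊆ : ∀ X i → X ∩ S i ⊆ X ∩ preimage f (ground (M i))
  ∩-S⊆ X i x∈ with x∈X , x∈S ← x∈p∩q⁻ X (S i) x∈ =
    x∈p∩q⁺ (x∈X , p∩q⊆p (preimage f (ground (M i))) (ground G) x∈S)
  ⊆∩-S : ∀ X i → X ⊆ ground G → X ∩ preimage f (ground (M i)) ⊆ X ∩ S i
  ⊆∩-S X i X⊆ x∈ with x∈X , x∈f⁻¹ ← x∈p∩q⁻ X (preimage f (ground (M i))) x∈ =
    x∈p∩q⁺ (x∈X , x∈p∩q⁺ (x∈f⁻¹ , X⊆ x∈X))

-- `preimage id q` is `tabulate (lookup q)`, which does not reduce to `q`. This inclusion and the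
-- next bridge the gap when `matchoid-pullback` is used with `f = id`.
∩-preimage-id⊆ : ∀ (p q : Subset n) → p ∩ preimage id q ⊆ p ∩ q
∩-preimage-id⊆ p q x∈ with x∈p , x∈q ← x∈p∩q⁻ p (preimage id q) x∈ =
  x∈p∩q⁺ (x∈p , ∈-preimage⁻ id q x∈q)

∩⊆∩-preimage-id : ∀ (p q : Subset n) → p ∩ q ⊆ p ∩ preimage id q
∩⊆∩-preimage-id p q x∈ with x∈p , x∈q ← x∈p∩q⁻ p q x∈ =
  x∈p∩q⁺ (x∈p , ∈-preimage⁺ id q x∈q)

matchoid-closed : ∀ {k} → ClosedUnderOperations (IsMatchoid k)
matchoid-closed {k} {n} F (N , M , exchange , ground≡ , count , Ind⇔) =
    -- If `s` is not in `S i`, then `parallel (M i) s` still has `s₁` and `s₂` in its ground set, as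
    -- loops. The restriction to the preimage of `S i` inside `matchoid-pullback` removes them.
    (λ {s} s∈ _ → matchoid-pullback F (parallel F s) M (λ i → parallel (M i) s) (ρ s)
      ground≡ count (∈-ground∘⁻ s F s∈)
      (λ i → parallel-isMatroid (M i) s (exchange i))
      (parallel-Ind⇔ s s∈))
  , (λ {Y} Y⊆ → matchoid-pullback F (restrict F Y) M M id ground≡ count Y⊆ exchange λ X X⊆Y → mk⇔
      (λ (_ , indX) i → closed (M i) (∩-preimage-id⊆ X (S i)) (ind-∩ indX i))
      (λ indX → (λ {x} → X⊆Y {x}) , from (Ind⇔ X) ((λ x∈ → Y⊆ (X⊆Y x∈))
        , λ i → closed (M i) (∩⊆∩-preimage-id X (S i)) (indX i))))
  , (λ {K} indK → matchoid-pullback F (contract F K indK) M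
      (λ i → contract (M i) (K ∩ S i) (ind-∩ indK i)) id
      ground≡ count (p─q⊆p (ground F) K)
      (λ i → contract-isMatroid (M i) (ind-∩ indK i) (exchange i))
      (contract-Ind⇔ indK))
  where
  S : Fin N → Subset n
  S i = ground (M i)

  ind-∩ : ∀ {X} → Ind F X → ∀ i → Ind (M i) (X ∩ S i)
  ind-∩ {X} indX = proj₂ (to (Ind⇔ X) indX)

  parallel-Ind⇔ : ∀ s → s ∈ ground F → ∀ X → X ⊆ ground (parallel F s) →
    Ind (parallel F s) X ⇔ (∀ i → Ind (parallel (M i) s) (X ∩ preimage (ρ s) (S i)))
  parallel-Ind⇔ s s∈ X X⊆ = mk⇔
    (λ indX i → parallel-ind⁺ s (M i)
      (λ x∈ → ∈-ground∘⁺ s (M i) (∈-preimage⁻ (ρ s) (S i) (p∩q⊆q X (S⁻¹ i) x∈))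
                (∈-ground∘⇒≢ s F (X⊆ (p∩q⊆p X (S⁻¹ i) x∈))))
      (injectiveOn-⊆ (p∩q⊆p X (S⁻¹ i)) (parallel-injective s F indX))
      (closed (M i)
        (λ e∈ → x∈p∩q⁺ (π-mono s X (X ∩ S⁻¹ i) (p∩q⊆p X (S⁻¹ i)) e∈ , π-∩-preimage⊆ s X (S i) e∈))
        (ind-∩ (parallel-π-ind s F indX) i)))
    (λ indX → parallel-ind⁺ s F X⊆
      (λ {x} {y} x∈ y∈ eq →
        -- The sets `S i` cover the ground set, so some `S i` contains the common image of `x` and
        -- `y`; injectivity for that single `i` already gives `x ≡ y`.
        let i , ρx∈ = ∈-⋃-tabulate⁻ S (subst (ρ s x ∈_) ground≡ (∈-ground∘⁻ s F s∈ (X⊆ x∈)))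
        in parallel-injective s (M i) (indX i)
             (x∈p∩q⁺ (x∈ , ∈-preimage⁺ (ρ s) (S i) ρx∈))
             (x∈p∩q⁺ (y∈ , ∈-preimage⁺ (ρ s) (S i) (subst (_∈ S i) eq ρx∈)))
             eq)
      (from (Ind⇔ (π s X))
        ( π-least s X (∈-ground∘⁻ s F s∈ ∘ X⊆)
        , λ i → closed (M i) (π-∩⊆ i) (parallel-π-ind s (M i) (indX i)))))
    where
    S⁻¹ : Fin N → Subset (2 + n)
    S⁻¹ i = preimage (ρ s) (S i)
    π-∩⊆ : ∀ i → π s X ∩ S i ⊆ π s (X ∩ S⁻¹ i)
    π-∩⊆ i e∈ with e∈π , e∈S ← x∈p∩q⁻ (π s X) (S i) e∈ with x , x∈X , refl ← ∈-π⁻ s X e∈π =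
      ∈-π⁺ s (X ∩ S⁻¹ i) (x∈p∩q⁺ (x∈X , ∈-preimage⁺ (ρ s) (S i) e∈S))

  -- Each matroid contracts the trace of `K` on its own ground set; the equivalence holds because
  -- the trace of `X ∪ K` on `S i` is the union of the traces of `X` and `K`.
  contract-Ind⇔ : ∀ {K} (indK : Ind F K) X → X ⊆ ground F ─ K →
    Ind (contract F K indK) X ⇔
    (∀ i → Ind (contract (M i) (K ∩ S i) (ind-∩ indK i)) (X ∩ preimage id (S i)))
  contract-Ind⇔ {K} indK X X⊆ = mk⇔
    (λ (_ , indX) i →
        (λ {x} → ∩⊆─ i {x})
      , closed (M i)
          (∪-lub (∩-monoˡ (S i) (p⊆p∪q K) ∘ ∩-preimage-id⊆ X (S i)) (∩-monoˡ (S i) (q⊆p∪q X K)))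
          (ind-∩ indX i))
    (λ indX → (λ {x} → X⊆ {x}) , from (Ind⇔ (X ∪ K))
      ( ∪-lub (p─q⊆p (ground F) K ∘ X⊆) (ind⊆ground F indK)
      , λ i → closed (M i) (⊆∪ i) (proj₂ (indX i))))
    where
    ⊆∪ : ∀ i → (X ∪ K) ∩ S i ⊆ (X ∩ preimage id (S i)) ∪ (K ∩ S i)
    ⊆∪ i x∈ with x∈∪ , x∈S ← x∈p∩q⁻ (X ∪ K) (S i) x∈ with x∈p∪q⁻ X K x∈∪
    ... | inj₁ x∈X = p⊆p∪q (K ∩ S i) (∩⊆∩-preimage-id X (S i) (x∈p∩q⁺ (x∈X , x∈S)))
    ... | inj₂ x∈K = q⊆p∪q (X ∩ preimage id (S i)) (K ∩ S i) (x∈p∩q⁺ (x∈K , x∈S))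
    ∩⊆─ : ∀ i → X ∩ preimage id (S i) ⊆ S i ─ (K ∩ S i)
    ∩⊆─ i x∈ with x∈X , x∈S ← x∈p∩q⁻ X (S i) (∩-preimage-id⊆ X (S i) x∈) =
      x∈p∧x∉q⇒x∈p─q x∈S (proj₂ (x∈p─q⁻ (ground F) K (X⊆ x∈X)) ∘ p∩q⊆p K (S i))

-- Circuit bounded systems

-- Elements are deleted as long as the set stays dependent. Once every single deletion gives an
-- independent set, any proper subset lies in some `X - x`, so the remaining set is a circuit.
dependent⇒∃circuit : ∀ (F : IndependenceSystem n) {X} → X ⊆ ground F → ¬ Ind F X →
  ∃[ C ] IsCircuit F C × C ⊆ X
dependent⇒∃circuit F {X} X⊆ dep = go X (⊂-wellFounded X) X⊆ dep
  where
  go : ∀ X → Acc _⊂_ X → X ⊆ ground F → ¬ Ind F X → ∃[ C ] IsCircuit F C × C ⊆ X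
  go X (acc rec) X⊆ dep with any? (λ x → x ∈? X ×-dec ¬? (Ind? F (X - x)))
  ... | yes (x , x∈X , dep′)
    with C , circ , C⊆ ← go (X - x) (rec (x∈p⇒p-x⊂p x∈X)) (X⊆ ∘ p─q⊆p X ⁅ x ⁆) dep′ =
    C , circ , p─q⊆p X ⁅ x ⁆ ∘ C⊆
  ... | no ∄x = X , record { ⊆ground = X⊆ ; dependent = dep ; minimal = min } , id
    where
    min : ∀ {D} → D ⊂ X → Ind F D
    min {D} (D⊆X , x , x∈X , x∉D) = closed F
      (λ y∈D → x∈p∧x≢y⇒x∈p-y (D⊆X y∈D) λ { refl → x∉D y∈D })
      (decidable-stable (Ind? F (X - x)) (λ dep′ → ∄x (x , x∈X , dep′)))

circuit-⊆-dependent : ∀ (F : IndependenceSystem n) {C D} → IsCircuit F C → D ⊆ C → ¬ Ind F D → C ≡ D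
circuit-⊆-dependent F {C} {D} circ D⊆C dep = ⊆-antisym C⊆D D⊆C
  where
  C⊆D : C ⊆ D
  C⊆D {x} x∈C = decidable-stable (x ∈? D) (λ x∉D → dep (minimal circ (D⊆C , x , x∈C , x∉D)))

All-image⇒map : ∀ {A B : Set} {P : A → Set} {Q : B → Set} (h : B → A) →
  (∀ {x} → P x → ∃[ y ] Q y × x ≡ h y) →
  ∀ {xs} → All P xs → ∃[ ys ] All Q ys × xs ≡ map h ys
All-image⇒map h lift []         = [] , [] , refl
All-image⇒map h lift (px ∷ pxs)
  with y , qy , refl ← lift px | ys , qys , refl ← All-image⇒map h lift pxs =
  y ∷ ys , qy ∷ qys , refl

-- Every circuit counted for `Y` is a value of one function `h` at a circuit counted for `X`.
-- Distinct values have distinct arguments, so a duplicate-free list of the former yields one of the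
-- latter of equal length.
atMostCircuits-transfer : ∀ {k} {F : IndependenceSystem n} {G : IndependenceSystem m} {X Y}
  (h : Subset n → Subset m) →
  (∀ {C} → IsCircuit G C → C ⊆ Y → ∃[ D ] (IsCircuit F D × D ⊆ X) × C ≡ h D) →
  ContainsAtMostCircuits k F X → ContainsAtMostCircuits k G Y
atMostCircuits-transfer {k = k} h lift bound Cs Cs! circs
  with Ds , circs′ , refl ← All-image⇒map h (λ (circ , C⊆) → lift circ C⊆) circs =
  subst (_≤ k) (sym (length-map h Ds)) (bound Ds (map⁻ Cs!) circs′)

atMostOneCircuit : ∀ {k} {F : IndependenceSystem n} {X} E → 1 ≤ k →
  (∀ {C} → IsCircuit F C → C ⊆ X → C ≡ E) → ContainsAtMostCircuits k F X
atMostOneCircuit E 1≤k unique []           _                 _ = z≤n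
atMostOneCircuit E 1≤k unique (C ∷ [])     _                 _ = 1≤k
atMostOneCircuit E 1≤k unique (C ∷ D ∷ Cs) ((C≢D ∷ _) ∷ _) ((circ , C⊆) ∷ (circ′ , D⊆) ∷ _) =
  contradiction (trans (unique circ C⊆) (sym (unique circ′ D⊆))) C≢D

restrict-circuit : ∀ (F : IndependenceSystem n) {Y C} → Y ⊆ ground F →
  IsCircuit (restrict F Y) C → IsCircuit F C
restrict-circuit F Y⊆ circ = record
  { ⊆ground   = Y⊆ ∘ ⊆ground circ
  ; dependent = λ ind → dependent circ ((λ {x} → ⊆ground circ {x}) , ind)
  ; minimal   = proj₂ ∘ minimal circ
  }

-- `C ∪ K` is dependent in `F` and so contains a circuit `D`. Then `D ─ K` is a subset of `C` that
-- is dependent in the contraction, and minimality of `C` forces equality.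
contract-circuit : ∀ (F : IndependenceSystem n) {K C} (indK : Ind F K) → IsCircuit (contract F K indK) C →
  ∃[ D ] IsCircuit F D × D ⊆ C ∪ K × C ≡ D ─ K
contract-circuit F {K} {C} indK circ
  with D , circ′ , D⊆ ← dependent⇒∃circuit F
         (∪-lub (p─q⊆p (ground F) K ∘ ⊆ground circ) (ind⊆ground F indK))
         (λ ind → dependent circ ((λ {x} → ⊆ground circ {x}) , ind)) =
  D , circ′ , D⊆ , circuit-⊆-dependent (contract F K indK) circ ─⊆C
    (λ (_ , ind) → dependent circ′ (closed F ⊆─∪ ind))
  where
  ─⊆C : D ─ K ⊆ C
  ─⊆C x∈ with x∈D , x∉K ← x∈p─q⁻ D K x∈ with x∈p∪q⁻ C K (D⊆ x∈D)
  ... | inj₁ x∈C = x∈C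
  ... | inj₂ x∈K = contradiction x∈K x∉K
  ⊆─∪ : D ⊆ (D ─ K) ∪ K
  ⊆─∪ {x} x∈D with x ∈? K
  ... | yes x∈K = q⊆p∪q (D ─ K) K x∈K
  ... | no  x∉K = p⊆p∪q K (x∈p∧x∉q⇒x∈p─q x∈D x∉K)

-- For minimality: a proper subset `D` of `π s C` misses some `ρ s x` with `x ∈ C`, so
-- `C ∩ preimage (ρ s) D` is a proper subset of `C`, hence independent, and its image contains `D`.
parallel-circuit : ∀ (F : IndependenceSystem n) {s C} → s ∈ ground F →
  IsCircuit (parallel F s) C → InjectiveOn (ρ s) C → IsCircuit F (π s C)
parallel-circuit F {s} {C} s∈ circ inj = record
  { ⊆ground   = π-least s C (∈-ground∘⁻ s F s∈ ∘ ⊆ground circ)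
  ; dependent = λ ind → dependent circ (parallel-ind⁺ s F (⊆ground circ) inj ind)
  ; minimal   = min
  }
  where
  min : ∀ {D} → D ⊂ π s C → Ind F D
  min {D} (D⊆ , e , e∈π , e∉D) with x , x∈C , refl ← ∈-π⁻ s C e∈π =
    closed F (⊆-π-∩-preimage s C D⊆) (parallel-π-ind s F (minimal circ
      ( p∩q⊆p C (preimage (ρ s) D)
      , x , x∈C , e∉D ∘ ∈-preimage⁻ (ρ s) D ∘ p∩q⊆q C (preimage (ρ s) D))))

circuitBounded-closed : ∀ {k} → 1 ≤ k → ClosedUnderOperations (IsCircuitBounded k)
circuitBounded-closed {k} 1≤k {n} F bounded =
    (λ s∈ _ → parallel-bounded s∈)
  , (λ Y⊆ (_ , indI) e∈ e∉ → atMostCircuits-transfer id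
      (λ circ C⊆ → _ , (restrict-circuit F Y⊆ circ , λ {x} → C⊆ {x}) , refl)
      (bounded indI (Y⊆ e∈) e∉))
  , contract-bounded
  where
  contract-bounded : ∀ {K} (indK : Ind F K) → IsCircuitBounded k (contract F K indK)
  contract-bounded {K} indK {I} {e} (_ , indI) e∈ e∉I
    with e∈F , e∉K ← x∈p─q⁻ (ground F) K e∈ =
    atMostCircuits-transfer (_─ K)
      (λ circ C⊆ → let D , circ′ , D⊆ , C≡ = contract-circuit F indK circ
                   in D , (circ′ , λ {x} → I∪⊆ C⊆ ∘ D⊆ {x}) , C≡)
      (bounded indI e∈F ([ e∉I , e∉K ]′ ∘ x∈p∪q⁻ I K))
    where
    I∪⊆ : ∀ {C} → C ⊆ I ∪ ⁅ e ⁆ → C ∪ K ⊆ (I ∪ K) ∪ ⁅ e ⁆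
    I∪⊆ C⊆ = ∪-lub (∪-monoˡ ⁅ e ⁆ (p⊆p∪q K) ∘ C⊆) (p⊆p∪q ⁅ e ⁆ ∘ q⊆p∪q I K)

  parallel-bounded : ∀ {s} → s ∈ ground F → IsCircuitBounded k (parallel F s)
  parallel-bounded {s} s∈ {I} {y} indI y∈ y∉I with ρ s y ∈? π s I
  -- Here `ρ s` is injective on `I ∪ ⁅ y ⁆`, so a circuit inside that set is recovered from its
  -- image by taking the preimage.
  ... | no ρy∉ = atMostCircuits-transfer (λ D → (I ∪ ⁅ y ⁆) ∩ preimage (ρ s) D)
      (λ {C} circ C⊆ → π s C
        , ( parallel-circuit F s∈ circ (injectiveOn-⊆ C⊆ inj)
          , λ {x} x∈ → π-∪⁅⁆⊆ s I y (π-mono s (I ∪ ⁅ y ⁆) C C⊆ x∈))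
        , ⊆-antisym (λ x∈ → x∈p∩q⁺ (C⊆ x∈ , ∈-preimage⁺ (ρ s) (π s C) (∈-π⁺ s C x∈))) (⊆C C⊆))
      (bounded (parallel-π-ind s F indI) (∈-ground∘⁻ s F s∈ y∈) ρy∉)
    where
    inj : InjectiveOn (ρ s) (I ∪ ⁅ y ⁆)
    inj = injectiveOn-∪⁅⁆ s (parallel-injective s F indI) ρy∉
    ⊆C : ∀ {C} → C ⊆ I ∪ ⁅ y ⁆ → (I ∪ ⁅ y ⁆) ∩ preimage (ρ s) (π s C) ⊆ C
    ⊆C {C} C⊆ x∈ with x∈∪ , x∈ρ⁻¹ ← x∈p∩q⁻ (I ∪ ⁅ y ⁆) _ x∈
      with z , z∈C , eq ← ∈-π⁻ s C (∈-preimage⁻ (ρ s) (π s C) x∈ρ⁻¹)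
      = subst (_∈ C) (inj (C⊆ z∈C) x∈∪ eq) z∈C
  -- Now `y` is parallel to `z ∈ I`. A circuit in `I ∪ ⁅ y ⁆` contains `y` because `I` is
  -- independent, and `z` because exchanging `z` for `y` keeps independence. The pair is itself
  -- dependent, so it is the only possible circuit.
  ... | yes ρy∈ with z , z∈I , ρz≡ρy ← ∈-π⁻ s I ρy∈ = atMostOneCircuit (⁅ z ⁆ ∪ ⁅ y ⁆) 1≤k
      (λ circ C⊆ → circuit-⊆-dependent (parallel F s) circ
        (∪-lub (⁅x⁆⊆p (z∈C circ C⊆)) (⁅x⁆⊆p (y∈C circ C⊆)))
        (λ ind → contradiction
          (subst (_∈ I) (parallel-injective s F ind (p⊆p∪q ⁅ y ⁆ (x∈⁅x⁆ z)) (x∈p∪⁅x⁆ ⁅ z ⁆ y) ρz≡ρy) z∈I)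
          y∉I))
    where
    y∈C : ∀ {C} → IsCircuit (parallel F s) C → C ⊆ I ∪ ⁅ y ⁆ → y ∈ C
    y∈C {C} circ C⊆ = decidable-stable (y ∈? C) λ y∉C → dependent circ (closed (parallel F s)
      (λ x∈ → [ id , (λ { refl → contradiction x∈ y∉C }) ]′ (x∈p∪⁅y⁆⁻ I (C⊆ x∈))) indI)
    z∈C : ∀ {C} → IsCircuit (parallel F s) C → C ⊆ I ∪ ⁅ y ⁆ → z ∈ C
    z∈C {C} circ C⊆ = decidable-stable (z ∈? C) λ z∉C → dependent circ (closed (parallel F s)
      (λ x∈ → x∈p∧x≢y⇒x∈p-y (C⊆ x∈) λ { refl → z∉C x∈ })
      (parallel-swap s F indI y∈ z∈I (sym ρz≡ρy)))

-- Growth systems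

-- For an independent `Q` between `P ∪ K` and `X ∪ K`, the set `Q ─ K` contains `P` and is
-- independent in the contraction, so maximality of `P` gives `P ≡ Q ─ K`.
contract-basis : ∀ (F : IndependenceSystem n) {K X P} (indK : Ind F K) → X ⊆ ground F ─ K →
  IsBasis (contract F K indK) X P → IsBasis F (X ∪ K) (P ∪ K)
contract-basis F {K} {X} {P} indK X⊆ basis = record
  { ⊆X          = ∪-monoˡ K (⊆X basis)
  ; independent = proj₂ (independent basis)
  ; maximal     = max
  }
  where
  max : ∀ {Q} → Q ⊆ X ∪ K → Ind F Q → P ∪ K ⊆ Q → P ∪ K ≡ Q
  max {Q} Q⊆ indQ P∪K⊆Q = ⊆-antisym P∪K⊆Q ⊆P∪K
    where
    ─⊆X : Q ─ K ⊆ X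
    ─⊆X x∈ with x∈Q , x∉K ← x∈p─q⁻ Q K x∈ with x∈p∪q⁻ X K (Q⊆ x∈Q)
    ... | inj₁ x∈X = x∈X
    ... | inj₂ x∈K = contradiction x∈K x∉K
    P≡Q─K : P ≡ Q ─ K
    P≡Q─K = maximal basis ─⊆X
      ( (λ {x} x∈ → X⊆ (─⊆X {x} x∈))
      , closed F (∪-lub (p─q⊆p Q K) (P∪K⊆Q ∘ q⊆p∪q P K)) indQ)
      (λ x∈P → x∈p∧x∉q⇒x∈p─q (P∪K⊆Q (p⊆p∪q K x∈P))
        (proj₂ (x∈p─q⁻ (ground F) K (X⊆ (⊆X basis x∈P)))))
    ⊆P∪K : Q ⊆ P ∪ K
    ⊆P∪K {x} x∈Q with x ∈? K
    ... | yes x∈K = q⊆p∪q P K x∈K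
    ... | no  x∉K = p⊆p∪q K (subst (x ∈_) (sym P≡Q─K) (x∈p∧x∉q⇒x∈p─q x∈Q x∉K))

-- If an independent `D` between `π s P` and `π s X` had an element `ρ s x` outside `π s P`, with
-- `x ∈ X`, then `P ∪ ⁅ x ⁆` would be independent, against maximality of `P`.
parallel-basis : ∀ (F : IndependenceSystem n) {s X P} → X ⊆ ground (parallel F s) →
  IsBasis (parallel F s) X P → IsBasis F (π s X) (π s P)
parallel-basis F {s} {X} {P} X⊆ basis = record
  { ⊆X          = π-mono s X P (⊆X basis)
  ; independent = parallel-π-ind s F (independent basis)
  ; maximal     = λ D⊆ indD π⊆D → ⊆-antisym π⊆D (⊆π D⊆ indD π⊆D)
  }
  where
  ⊆π : ∀ {D} → D ⊆ π s X → Ind F D → π s P ⊆ D → D ⊆ π s P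
  ⊆π D⊆ indD π⊆D {e} e∈D with x , x∈X , refl ← ∈-π⁻ s X (D⊆ e∈D) =
    decidable-stable (ρ s x ∈? π s P) λ ρx∉ → ρx∉ (∈-π⁺ s P
      (subst (x ∈_)
        (sym (maximal basis (∪-lub (⊆X basis) (⁅x⁆⊆p x∈X))
          (parallel-insert s F (independent basis) (X⊆ x∈X) ρx∉
            (closed F (∪-lub π⊆D (⁅x⁆⊆p e∈D)) indD))
          (p⊆p∪q ⁅ x ⁆)))
        (x∈p∪⁅x⁆ P x)))

growth-closed : ∀ {k} → 1 ≤ k → ClosedUnderOperations (IsGrowth k)
growth-closed {k} 1≤k {n} F growth =
    (λ s∈ _ → parallel-growth s∈)
  , (λ Y⊆ {X} {I} X⊆Y (I⊆Y , indI) →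
      let Q , Z , (Q∪Z≡ , Q∩Z≡) , ∣Z∣≤ , grow = growth (Y⊆ ∘ X⊆Y) indI
      in Q , Z , (Q∪Z≡ , Q∩Z≡) , ∣Z∣≤ , λ basis →
           (λ {x} → ∪-lub (X⊆Y ∘ ⊆X basis)
             (I⊆Y ∘ p─q⊆p I X ∘ subst (_ ∈_) Q∪Z≡ ∘ p⊆p∪q Z) {x})
         , grow (restrict-basis X⊆Y basis))
  , contract-growth
  where
  restrict-basis : ∀ {X Y P} → X ⊆ Y → IsBasis (restrict F Y) X P → IsBasis F X P
  restrict-basis X⊆Y basis = record
    { ⊆X          = ⊆X basis
    ; independent = proj₂ (independent basis)
    ; maximal     = λ Q⊆X indQ → maximal basis Q⊆X ((λ {x} x∈ → X⊆Y (Q⊆X {x} x∈)) , indQ)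
    }

  -- Growth of `F` is applied to `X ∪ K` and `I ∪ K`. Adding `K` to both sets does not change
  -- `I ─ X`, as `I` is disjoint from `K`, and does not enlarge `X ─ I`.
  contract-growth : ∀ {K} (indK : Ind F K) → IsGrowth k (contract F K indK)
  contract-growth {K} indK {X} {I} X⊆ (I⊆ , indI)
    with Q , Z , (Q∪Z≡ , Q∩Z≡) , ∣Z∣≤ , grow ←
           growth (∪-lub (p─q⊆p (ground F) K ∘ X⊆) (ind⊆ground F indK)) indI =
    Q , Z , (trans Q∪Z≡ ─≡ , Q∩Z≡)
      , ≤-trans ∣Z∣≤ (*-monoʳ-≤ k (p⊆q⇒∣p∣≤∣q∣ (∪─∪⊆ X I)))
      , λ {P} basis →
          (λ {x} → ∪-lub (X⊆ ∘ ⊆X basis)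
            (I⊆ ∘ p─q⊆p I X ∘ subst (_ ∈_) (trans Q∪Z≡ ─≡) ∘ p⊆p∪q Z) {x})
        , ∪-ind-swap F P K Q (grow (contract-basis F indK X⊆ basis))
    where
    ∪─∪⊆ : ∀ A B → (A ∪ K) ─ (B ∪ K) ⊆ A ─ B
    ∪─∪⊆ A B x∈ with x∈∪ , x∉∪ ← x∈p─q⁻ (A ∪ K) (B ∪ K) x∈ with x∈p∪q⁻ A K x∈∪
    ... | inj₁ x∈A = x∈p∧x∉q⇒x∈p─q x∈A (x∉∪ ∘ p⊆p∪q K)
    ... | inj₂ x∈K = contradiction (q⊆p∪q B K x∈K) x∉∪
    ⊆∪─∪ : I ─ X ⊆ (I ∪ K) ─ (X ∪ K)
    ⊆∪─∪ x∈ with x∈I , x∉X ← x∈p─q⁻ I X x∈ = x∈p∧x∉q⇒x∈p─q (p⊆p∪q K x∈I)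
      ([ x∉X , proj₂ (x∈p─q⁻ (ground F) K (I⊆ x∈I)) ]′ ∘ x∈p∪q⁻ X K)
    ─≡ : (I ∪ K) ─ (X ∪ K) ≡ I ─ X
    ─≡ = ⊆-antisym (∪─∪⊆ I X) ⊆∪─∪

  -- Growth of `F` is applied to the images of `X` and `I`. The kept part `Q′` consists of the
  -- elements of `I` with image in `Q`; the image of `P ∪ Q′` lies in `π s P ∪ Q`, which is
  -- independent since `π s P` is a basis of `π s X`.
  parallel-growth : ∀ {s} → s ∈ ground F → IsGrowth k (parallel F s)
  parallel-growth {s} s∈ {X} {I} X⊆ indI
    with Q , Z , (Q∪Z≡ , Q∩Z≡) , ∣Z∣≤ , grow ←
           growth (π-least s X (∈-ground∘⁻ s F s∈ ∘ X⊆)) (parallel-π-ind s F indI) =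
    Q′ , Z′ , ─-isPartition Q′⊆ , ∣Z′∣≤ , λ {P} basis → parallel-ind⁺ s F
      (∪-lub (ind⊆ground (parallel F s) (independent basis))
             (ind⊆ground (parallel F s) indI ∘ p∩q⊆p I (preimage (ρ s) Q)))
      (inj∪ (⊆X basis) (parallel-injective s F (independent basis)))
      (closed F (∪-monoʳ (π s P) (π-∩-preimage⊆ s I Q) ∘ π-∪⊆ s P Q′)
        (grow (parallel-basis F X⊆ basis)))
    where
    inj = parallel-injective s F indI
    Q′ = I ∩ preimage (ρ s) Q
    Z′ = (I ─ X) ─ Q′
    -- V pays for the elements of I ─ X that are parallel to elements of X: the latter lie
    -- in X ─ I, whose image contains V besides π X ─ π I.
    V = π s (X ─ I) ∩ π s I
    Q∌πX : ∀ {e} → e ∈ Q → e ∉ π s X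
    Q∌πX e∈Q = proj₂ (x∈p─q⁻ (π s I) (π s X) (subst (_ ∈_) Q∪Z≡ (p⊆p∪q Z e∈Q)))
    ρQ′ : ∀ {x} → x ∈ Q′ → ρ s x ∈ Q
    ρQ′ = ∈-preimage⁻ (ρ s) Q ∘ p∩q⊆q I (preimage (ρ s) Q)
    Q′⊆ : Q′ ⊆ I ─ X
    Q′⊆ x∈ = x∈p∧x∉q⇒x∈p─q (p∩q⊆p I (preimage (ρ s) Q) x∈) (Q∌πX (ρQ′ x∈) ∘ ∈-π⁺ s X)
    ρZ′ : ∀ {x} → x ∈ Z′ → ρ s x ∈ Z ∪ V
    ρZ′ {x} x∈ with x∈I─X , x∉Q′ ← x∈p─q⁻ (I ─ X) Q′ x∈ with x∈I , x∉X ← x∈p─q⁻ I X x∈I─X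
      with ρ s x ∈? π s X
    -- Here `x` is parallel to some `y ∈ X`. If `y` were in `I`, injectivity on `I` would give
    -- `y ≡ x`, contrary to `x ∉ X`; so the common image lies in `V`.
    ... | yes ρx∈ with y , y∈X , ρy≡ρx ← ∈-π⁻ s X ρx∈ = q⊆p∪q Z V (x∈p∩q⁺
      ( subst (_∈ π s (X ─ I)) ρy≡ρx (∈-π⁺ s (X ─ I) (x∈p∧x∉q⇒x∈p─q y∈X
          λ y∈I → x∉X (subst (_∈ X) (inj y∈I x∈I ρy≡ρx) y∈X)))
      , ∈-π⁺ s I x∈I))
    ... | no  ρx∉ with x∈p∪q⁻ Q Z (subst (ρ s x ∈_) (sym Q∪Z≡) (x∈p∧x∉q⇒x∈p─q (∈-π⁺ s I x∈I) ρx∉))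
    ...   | inj₁ ρx∈Q = contradiction (x∈p∩q⁺ (x∈I , ∈-preimage⁺ (ρ s) Q ρx∈Q)) x∉Q′
    ...   | inj₂ ρx∈Z = p⊆p∪q V ρx∈Z
    π─π⊆ : π s X ─ π s I ⊆ π s (X ─ I)
    π─π⊆ e∈ with e∈πX , e∉πI ← x∈p─q⁻ (π s X) (π s I) e∈ with x , x∈X , refl ← ∈-π⁻ s X e∈πX =
      ∈-π⁺ s (X ─ I) (x∈p∧x∉q⇒x∈p─q x∈X (e∉πI ∘ ∈-π⁺ s I))
    ∣π─π∣+∣V∣≤ : ∣ π s X ─ π s I ∣ + ∣ V ∣ ≤ ∣ π s (X ─ I) ∣
    ∣π─π∣+∣V∣≤ = disjoint⇒∣p∣+∣q∣≤∣r∣ (π s X ─ π s I) V (π s (X ─ I))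
      π─π⊆ (p∩q⊆p (π s (X ─ I)) (π s I))
      (λ e∈ → proj₂ (x∈p─q⁻ (π s X) (π s I) e∈) ∘ p∩q⊆q (π s (X ─ I)) (π s I))
    injZ′ : InjectiveOn (ρ s) Z′
    injZ′ = injectiveOn-⊆ (p─q⊆p I X ∘ p─q⊆p (I ─ X) Q′) inj
    ∣Z′∣≤ : ∣ Z′ ∣ ≤ k * ∣ X ─ I ∣
    ∣Z′∣≤ = begin
      ∣ Z′ ∣                             ≤⟨ injectiveOn⇒∣p∣≤∣q∣ (ρ s) Z′ injZ′ ρZ′ ⟩
      ∣ Z ∪ V ∣                          ≤⟨ ∣p∪q∣≤∣p∣+∣q∣ Z V ⟩
      -- By `1 ≤ k`, the size of `V` is at most `k` times itself, so that `V` can be charged at the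
      -- same rate as `Z`.
      ∣ Z ∣ + ∣ V ∣                      ≤⟨ +-mono-≤ ∣Z∣≤ (m≤n*m ∣ V ∣ k ⦃ >-nonZero 1≤k ⦄) ⟩
      k * ∣ π s X ─ π s I ∣ + k * ∣ V ∣  ≡⟨ *-distribˡ-+ k ∣ π s X ─ π s I ∣ ∣ V ∣ ⟨
      k * (∣ π s X ─ π s I ∣ + ∣ V ∣)    ≤⟨ *-monoʳ-≤ k ∣π─π∣+∣V∣≤ ⟩
      k * ∣ π s (X ─ I) ∣                ≤⟨ *-monoʳ-≤ k (∣π∣≤ s (X ─ I)) ⟩
      k * ∣ X ─ I ∣                      ∎
      where open ≤-Reasoning
    -- No clash occurs between `P` and `Q′`: images of `P` lie in `π s X`, which `Q` avoids.
    inj∪ : ∀ {P} → P ⊆ X → InjectiveOn (ρ s) P → InjectiveOn (ρ s) (P ∪ Q′)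
    inj∪ {P} P⊆X injP v∈ w∈ eq with x∈p∪q⁻ P Q′ v∈ | x∈p∪q⁻ P Q′ w∈
    ... | inj₁ v∈P | inj₁ w∈P = injP v∈P w∈P eq
    ... | inj₁ v∈P | inj₂ w∈Q = contradiction
      (subst (_∈ π s X) eq (∈-π⁺ s X (P⊆X v∈P))) (Q∌πX (ρQ′ w∈Q))
    ... | inj₂ v∈Q | inj₁ w∈P = contradiction
      (subst (_∈ π s X) (sym eq) (∈-π⁺ s X (P⊆X w∈P))) (Q∌πX (ρQ′ v∈Q))
    ... | inj₂ v∈Q | inj₂ w∈Q = inj (p∩q⊆p I (preimage (ρ s) Q) v∈Q)
      (p∩q⊆p I (preimage (ρ s) Q) w∈Q) eq

-- Extendible systems

extendible-closed : ∀ {k} → 1 ≤ k → ClosedUnderOperations (IsExtendible k)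
extendible-closed {k} 1≤k {n} F extend =
    (λ s∈ _ → parallel-extendible s∈)
  , (λ Y⊆ {A} {B} {e} A⊆B (B⊆Y , indB) e∈Y e∉B (_ , indA∪e) →
      let Z , Z⊆ , ∣Z∣≤ , ind = extend A⊆B indB (Y⊆ e∈Y) e∉B indA∪e
      in Z , (λ {x} → Z⊆ {x}) , ∣Z∣≤
           , (λ {x} → ∪-lub B⊆Y (⁅x⁆⊆p e∈Y) ∘ p─q⊆p (B ∪ ⁅ e ⁆) Z {x}) , ind)
  , contract-extendible
  where
  -- Extendibility of `F` is applied to `A ∪ K ⊆ B ∪ K`. The deleted set avoids `A ∪ K`, so it lies
  -- in `B ─ A` and `K` survives the deletion.
  contract-extendible : ∀ {K} (indK : Ind F K) → IsExtendible k (contract F K indK)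
  contract-extendible {K} indK {A} {B} {e} A⊆B (B⊆ , indB) e∈ e∉B (_ , indA∪e)
    with e∈F , e∉K ← x∈p─q⁻ (ground F) K e∈
    with Z , Z⊆ , ∣Z∣≤ , ind ← extend (∪-monoˡ K A⊆B) indB e∈F ([ e∉B , e∉K ]′ ∘ x∈p∪q⁻ B K)
           (∪-ind-swap F A ⁅ e ⁆ K indA∪e) =
    Z , Z⊆B─A , ∣Z∣≤
      , (λ {x} → ∪-lub B⊆ (⁅x⁆⊆p e∈) ∘ p─q⊆p (B ∪ ⁅ e ⁆) Z {x})
      , closed F (∪-lub ─⊆ K⊆) ind
    where
    Z⊆B─A : Z ⊆ B ─ A
    Z⊆B─A x∈Z with x∈∪ , x∉∪ ← x∈p─q⁻ (B ∪ K) (A ∪ K) (Z⊆ x∈Z) with x∈p∪q⁻ B K x∈∪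
    ... | inj₁ x∈B = x∈p∧x∉q⇒x∈p─q x∈B (x∉∪ ∘ p⊆p∪q K)
    ... | inj₂ x∈K = contradiction (q⊆p∪q A K x∈K) x∉∪
    ─⊆ : (B ∪ ⁅ e ⁆) ─ Z ⊆ ((B ∪ K) ∪ ⁅ e ⁆) ─ Z
    ─⊆ x∈ with x∈∪ , x∉Z ← x∈p─q⁻ (B ∪ ⁅ e ⁆) Z x∈ =
      x∈p∧x∉q⇒x∈p─q (∪-monoˡ ⁅ e ⁆ (p⊆p∪q K) x∈∪) x∉Z
    K⊆ : K ⊆ ((B ∪ K) ∪ ⁅ e ⁆) ─ Z
    K⊆ x∈K = x∈p∧x∉q⇒x∈p─q (p⊆p∪q ⁅ e ⁆ (q⊆p∪q B K x∈K))
      λ x∈Z → proj₂ (x∈p─q⁻ (B ∪ K) (A ∪ K) (Z⊆ x∈Z)) (q⊆p∪q A K x∈K)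

  parallel-extendible : ∀ {s} → s ∈ ground F → IsExtendible k (parallel F s)
  parallel-extendible {s} s∈ {A} {B} {y} A⊆B indB y∈ y∉B indA∪y with ρ s y ∈? π s B
  -- Only the element `z` parallel to `y` has to go. It is not in `A`, since `A ∪ ⁅ y ⁆` is
  -- independent and cannot contain two parallel elements.
  ... | yes ρy∈ with z , z∈B , ρz≡ρy ← ∈-π⁻ s B ρy∈ =
    ⁅ z ⁆ , ⁅x⁆⊆p (x∈p∧x∉q⇒x∈p─q z∈B z∉A) , subst (_≤ k) (sym (∣⁅x⁆∣≡1 z)) 1≤k
      , parallel-swap s F indB y∈ z∈B (sym ρz≡ρy)
    where
    z∉A : z ∉ A
    z∉A z∈A = y∉B (subst (_∈ B)
      (parallel-injective s F indA∪y (p⊆p∪q ⁅ y ⁆ z∈A) (x∈p∪⁅x⁆ A y) ρz≡ρy) z∈B)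
  -- Otherwise the set `Z` obtained for the images is pulled back to `B`, which by injectivity on
  -- `B` does not increase its size.
  ... | no ρy∉
    with Z , Z⊆ , ∣Z∣≤ , ind ← extend (π-mono s B A A⊆B) (parallel-π-ind s F indB)
           (∈-ground∘⁻ s F s∈ y∈) ρy∉
           (closed F (∪-lub (π-mono s (A ∪ ⁅ y ⁆) A (p⊆p∪q ⁅ y ⁆))
                            (⁅x⁆⊆p (∈-π⁺ s (A ∪ ⁅ y ⁆) (x∈p∪⁅x⁆ A y))))
             (parallel-π-ind s F indA∪y)) =
    Z′ , Z′⊆ , ∣Z′∣≤ , parallel-ind⁺ s F
      (∪-lub (ind⊆ground (parallel F s) indB) (⁅x⁆⊆p y∈) ∘ p─q⊆p (B ∪ ⁅ y ⁆) Z′)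
      (injectiveOn-⊆ (p─q⊆p (B ∪ ⁅ y ⁆) Z′) (injectiveOn-∪⁅⁆ s inj ρy∉))
      (closed F (π-least s ((B ∪ ⁅ y ⁆) ─ Z′) ρ∈) ind)
    where
    inj = parallel-injective s F indB
    Z′ = B ∩ preimage (ρ s) Z
    ρZ′ : ∀ {x} → x ∈ Z′ → ρ s x ∈ Z
    ρZ′ = ∈-preimage⁻ (ρ s) Z ∘ p∩q⊆q B (preimage (ρ s) Z)
    Z′⊆ : Z′ ⊆ B ─ A
    Z′⊆ x∈ = x∈p∧x∉q⇒x∈p─q (p∩q⊆p B (preimage (ρ s) Z) x∈)
      (proj₂ (x∈p─q⁻ (π s B) (π s A) (Z⊆ (ρZ′ x∈))) ∘ ∈-π⁺ s A)
    ∣Z′∣≤ : ∣ Z′ ∣ ≤ k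
    ∣Z′∣≤ = ≤-trans
      (injectiveOn⇒∣p∣≤∣q∣ (ρ s) Z′ (injectiveOn-⊆ (p∩q⊆p B (preimage (ρ s) Z)) inj) ρZ′) ∣Z∣≤
    ρ∈ : ∀ {x} → x ∈ (B ∪ ⁅ y ⁆) ─ Z′ → ρ s x ∈ (π s B ∪ ⁅ ρ s y ⁆) ─ Z
    ρ∈ x∈ with x∈∪ , x∉Z′ ← x∈p─q⁻ (B ∪ ⁅ y ⁆) Z′ x∈ with x∈p∪⁅y⁆⁻ B x∈∪
    ... | inj₁ x∈B  = x∈p∧x∉q⇒x∈p─q (p⊆p∪q ⁅ ρ s y ⁆ (∈-π⁺ s B x∈B))
      λ ρx∈Z → x∉Z′ (x∈p∩q⁺ (x∈B , ∈-preimage⁺ (ρ s) Z ρx∈Z))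
    -- `Z` lies in `π s B`, which does not contain `ρ s y`.
    ... | inj₂ refl = x∈p∧x∉q⇒x∈p─q (x∈p∪⁅x⁆ (π s B) (ρ s y))
      (ρy∉ ∘ proj₁ ∘ x∈p─q⁻ (π s B) (π s A) ∘ Z⊆)

lemma9 : ∀ (k : ℕ) → 1 ≤ k →
    ClosedUnderOperations (IsMatroidIntersection k) ×
    ClosedUnderOperations (IsMatchoid k) ×
    ClosedUnderOperations (IsCircuitBounded k) ×
    ClosedUnderOperations (IsGrowth k) ×
    ClosedUnderOperations (IsExtendible k)
lemma9 k 1≤k =
    matroidIntersection-closed 1≤k
  , matchoid-closed
  , circuitBounded-closed 1≤k
  , growth-closed 1≤k
  , extendible-closed 1≤k
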